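{- For any $n>2$ and $k\ge 2$ (with $k\le n$), there exists an $(n,k)$-selective family of size $O(k\log(n/k))$.
   Context: Write $[n]=\{1,\dots,n\}$. For integers $k\le n$, a family $\mathcal F$ of subsets of $[n]$ is $(n,k)$-selective if for every non-empty $Z\subseteq[n]$ with $|Z|\le k$ there is $F\in\mathcal F$ with $|Z\cap F|=1$. The size of $\mathcal F$ is its number of members.
   Formalization: The bound is proved as O(k·max(1, log(n/k))): the logarithmic factor is taken to be at least 1, because at k = n the literal bound k log(n/k) is 0 while every (n,k)-selective family has at least k members. -}

module Defs where

open import Data.Fin.Subset using (Subset; Nonempty; _∩_; ∣_∣)
open import Data.List using (List; length)
open import Data.List.Relation.Unary.Any using (Any)
open import Data.List.Relation.Unary.Unique.Propositional using (Unique)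
open import Data.Nat using (ℕ; _≤_; _/_; _⊔_; NonZero)
open import Data.Nat.Logarithm using (⌊log₂_⌋)
open import Relation.Binary.PropositionalEquality using (_≡_)

-- The ground set [n] is Fin n. A family is a set of subsets, so its
-- members are listed without repetition and its size is the list's length.
record Family (n : ℕ) : Set where
  field
    members  : List (Subset n)
    distinct : Unique members

  size : ℕ
  size = length members

open Family public

Selective : (n k : ℕ) → Family n → Set
Selective n k 𝓕 =
  ∀ (Z : Subset n) → Nonempty Z → ∣ Z ∣ ≤ k →
  Any (λ F → ∣ Z ∩ F ∣ ≡ 1) (members 𝓕)

-- The factor log(n/k) of an O-bound, with the convention that a logarithmic
-- factor is at least 1. Without it the bound fails for k near n: at k = n
-- it would be 0, while an (n,k)-selective family has at least k members.
-- Integer division is harmless, as ⌊log₂ ⌊n/k⌋⌋ = ⌊log₂ (n/k)⌋ for k ≤ n.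
-- For x = log₂ (n/k) ≥ 0 we have max(1,x)/2 ≤ max(1,⌊x⌋) ≤ max(1,x), and
-- max(1,x) = x when k ≤ n/2, so rounding affects only the O-constant.
logRatio : (n k : ℕ) → .{{_ : NonZero k}} → ℕ
logRatio n k = 1 ⊔ ⌊log₂ (n / k) ⌋

{-# OPTIONS --safe #-}
module Submission where

-- Let F contain each point independently with probability 1/(2m). A set Z with m/2 ≤ |Z| ≤ m
-- is selected with probability at least 1/8, so given any list of such sets some F selects
-- an eighth of it. Choosing F greedily, O(log N) members select N sets. If n ≤ m·2^L then at
-- most 2^((L+2)m) sets have size ≤ m, so O(m(L+2)) members handle one scale m. Summing over
-- the scales k, k/2, k/4, … the halving of m beats the growth of L, and the total is O(k(L+4)).

open import Data.Bool using (true; false; if_then_else_)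
open import Data.Fin.Subset using (Subset; Nonempty; inside; outside; _∩_; ∣_∣; ⊤)
open import Data.Fin.Subset.Properties using (∩-identityʳ; x∈p⇒∣p-x∣<∣p∣)
open import Data.Bool.Properties using () renaming (_≟_ to _≟ᵇ_)
open import Data.List using (List; []; _∷_; [_]; _++_; map; length; filter; deduplicate)
open import Data.List.Membership.Propositional using (_∈_; find; lose)
open import Data.List.Membership.Propositional.Properties using (∈-map⁺; ∈-++⁺ˡ; ∈-++⁺ʳ; ∈-filter⁺; ∈-deduplicate⁺)
open import Data.List.Properties using (length-map; length-++; length-filter; length-deduplicate)
open import Data.List.Relation.Unary.All using (All; []; _∷_)
open import Data.List.Relation.Unary.All.Properties using (all-filter; filter⁺)
open import Data.List.Relation.Unary.Any using (Any; here; there)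
open import Data.List.Relation.Unary.Any.Properties using (++⁺ˡ; ++⁺ʳ)
open import Data.List.Relation.Unary.Unique.DecPropositional.Properties using (deduplicate-!)
open import Data.Nat using (ℕ; zero; suc; pred; _+_; _*_; _^_; _/_; _%_; _≤_; _<_; _>_; _≥_; _≡ᵇ_; _≟_; _≤?_; z≤n; s≤s;
  NonZero; ⌊_/2⌋; >-nonZero⁻¹)
open import Data.Nat.DivMod using (m≡m%n+[m/n]*n; m%n<n)
open import Data.Nat.Induction using (<-rec)
open import Data.Nat.Logarithm using (⌊log₂_⌋; ⌊log₂⌋-mono-≤; ⌊log₂[2^n]⌋≡n)
open import Data.Nat.Properties hiding (_≟_; _≤?_)
open import Data.Nat.Tactic.RingSolver using (solve-∀)
open import Data.Product using (∃-syntax; _×_; _,_; proj₂)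
open import Data.Sum using (inj₁; inj₂)
open import Data.Vec using ([]; _∷_)
open import Data.Vec.Properties using (≡-dec)
open import Defs
open import Function using (_∘_)
open import Relation.Binary.Definitions using (DecidableEquality)
open import Relation.Binary.PropositionalEquality using (_≡_; refl; sym; trans; cong; cong₂)
open import Relation.Nullary using (yes; no; ¬?; contradiction)
open import Relation.Nullary.Decidable using (_×-dec_)
open import Relation.Unary using (Decidable)

open ≤-Reasoning

-- Selection and expectation over a random subset.

infix 4 _Selects_

_Selects_ : ∀ {n} → Subset n → Subset n → Set
F Selects Z = ∣ Z ∩ F ∣ ≡ 1

[_≐_] : ℕ → ℕ → ℕ
[ a ≐ b ] = if a ≡ᵇ b then 1 else 0

-- (1 + q)ⁿ times the expectation of f over a random subset that contains each
-- point independently with probability 1 / (1 + q).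
𝔼 : ℕ → (n : ℕ) → (Subset n → ℕ) → ℕ
𝔼 q zero    f = f []
𝔼 q (suc n) f = 𝔼 q n (f ∘ (inside ∷_)) + q * 𝔼 q n (f ∘ (outside ∷_))

𝔼-zero : ∀ q n → 𝔼 q n (λ _ → 0) ≡ 0
𝔼-zero q zero    = refl
𝔼-zero q (suc n) rewrite 𝔼-zero q n = *-zeroʳ q

𝔼-+ : ∀ q n (f g : Subset n → ℕ) → 𝔼 q n (λ F → f F + g F) ≡ 𝔼 q n f + 𝔼 q n g
𝔼-+ q zero    f g = refl
𝔼-+ q (suc n) f g
  rewrite 𝔼-+ q n (f ∘ (inside ∷_)) (g ∘ (inside ∷_))
        | 𝔼-+ q n (f ∘ (outside ∷_)) (g ∘ (outside ∷_))
  = rearrange (𝔼 q n (f ∘ (inside ∷_))) _ q _ _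
  where
  rearrange : ∀ a b q c d → a + b + q * (c + d) ≡ a + q * c + (b + q * d)
  rearrange = solve-∀

-- First-moment principle: some outcome is at least the average. The weights `1` and `q` of the two
-- branches add up to `suc q`, so keeping the better branch at each point loses nothing.
𝔼-attained : ∀ q n (f : Subset n → ℕ) → ∃[ F ] 𝔼 q n f ≤ suc q ^ n * f F
𝔼-attained q zero    f = [] , ≤-reflexive (sym (*-identityˡ _))
𝔼-attained q (suc n) f
  with F , p ← 𝔼-attained q n (f ∘ (inside ∷_))
     | G , r ← 𝔼-attained q n (f ∘ (outside ∷_))
  with ≤-total (f (inside ∷ F)) (f (outside ∷ G))
... | inj₁ F≤G = outside ∷ G , (begin
    _                        ≤⟨ +-mono-≤ (≤-trans p (*-monoʳ-≤ (suc q ^ n) F≤G)) (*-monoʳ-≤ q r) ⟩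
    suc q * (suc q ^ n * _)  ≡⟨ *-assoc (suc q) (suc q ^ n) _ ⟨
    _                        ∎)
... | inj₂ G≤F = inside ∷ F , (begin
    _                        ≤⟨ +-mono-≤ p (*-monoʳ-≤ q (≤-trans r (*-monoʳ-≤ (suc q ^ n) G≤F))) ⟩
    suc q * (suc q ^ n * _)  ≡⟨ *-assoc (suc q) (suc q ^ n) _ ⟨
    _                        ∎)

-- Probability that a random subset selects a given set.

-- The union bounds P(Z ∩ F = ∅) ≥ 1 − zp and P(|Z ∩ F| = 1) ≥ zp(1 − zp), where
-- z = |Z| and p = 1 / (1 + q), cleared of denominators and subtractions.
miss-bound : ∀ q {n} (Z : Subset n) →
  suc q * suc q ^ n ≤ suc q * 𝔼 q n (λ F → [ ∣ Z ∩ F ∣ ≐ 0 ]) + ∣ Z ∣ * suc q ^ n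
miss-bound q []                = ≤-reflexive (sym (+-identityʳ _))
miss-bound q {suc n} (outside ∷ Z) = begin
  suc q * (suc q * P)                 ≤⟨ *-monoʳ-≤ (suc q) (miss-bound q Z) ⟩
  suc q * (suc q * e + ∣ Z ∣ * P)     ≡⟨ rearrange q P e ∣ Z ∣ ⟩
  suc q * (e + q * e) + ∣ Z ∣ * (suc q * P) ∎
  where
  P = suc q ^ n
  e = 𝔼 q n (λ F → [ ∣ Z ∩ F ∣ ≐ 0 ])
  rearrange : ∀ q P e z → (1 + q) * ((1 + q) * e + z * P) ≡ (1 + q) * (e + q * e) + z * ((1 + q) * P)
  rearrange = solve-∀
miss-bound q {suc n} (inside ∷ Z) rewrite 𝔼-zero q n = begin
  suc q * (suc q * P)                 ≡⟨⟩
  suc q * P + q * (suc q * P)         ≤⟨ +-monoʳ-≤ (suc q * P) (*-monoʳ-≤ q (miss-bound q Z)) ⟩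
  suc q * P + q * (suc q * e + ∣ Z ∣ * P)  ≤⟨ m≤m+n _ (∣ Z ∣ * P) ⟩
  suc q * P + q * (suc q * e + ∣ Z ∣ * P) + ∣ Z ∣ * P  ≡⟨ rearrange q P e ∣ Z ∣ ⟩
  suc q * (q * e) + suc ∣ Z ∣ * (suc q * P) ∎
  where
  P = suc q ^ n
  e = 𝔼 q n (λ F → [ ∣ Z ∩ F ∣ ≐ 0 ])
  rearrange : ∀ q P e z → (1 + q) * P + q * ((1 + q) * e + z * P) + z * P
                        ≡ (1 + q) * (q * e) + (1 + z) * ((1 + q) * P)
  rearrange = solve-∀

selects-bound : ∀ q {n} (Z : Subset n) →
  ∣ Z ∣ * (suc q * suc q ^ n) ≤
  suc q * (suc q * 𝔼 q n (λ F → [ ∣ Z ∩ F ∣ ≐ 1 ])) + ∣ Z ∣ * (∣ Z ∣ * suc q ^ n)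
selects-bound q []                = z≤n
selects-bound q {suc n} (outside ∷ Z) = begin
  z * (suc q * (suc q * P))                          ≡⟨ pull q P z ⟩
  suc q * (z * (suc q * P))                          ≤⟨ *-monoʳ-≤ (suc q) (selects-bound q Z) ⟩
  suc q * (suc q * (suc q * e) + z * (z * P))        ≡⟨ rearrange q P e z ⟩
  suc q * (suc q * (e + q * e)) + z * (z * (suc q * P)) ∎
  where
  z = ∣ Z ∣
  P = suc q ^ n
  e = 𝔼 q n (λ F → [ ∣ Z ∩ F ∣ ≐ 1 ])
  pull : ∀ q P z → z * ((1 + q) * ((1 + q) * P)) ≡ (1 + q) * (z * ((1 + q) * P))
  pull = solve-∀
  rearrange : ∀ q P e z → (1 + q) * ((1 + q) * ((1 + q) * e) + z * (z * P))
                        ≡ (1 + q) * ((1 + q) * (e + q * e)) + z * (z * ((1 + q) * P))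
  rearrange = solve-∀
-- If the head is in `F`, the tail has to be missed (`d`); if not, the tail has to be selected (`e`,
-- with weight `q`). Adding `z * (suc q * P)` to both sides keeps all terms positive.
selects-bound q {suc n} (inside ∷ Z) = +-cancelʳ-≤ (z * (suc q * P)) _ _ (begin
  suc z * (suc q * (suc q * P)) + z * (suc q * P)
    ≡⟨ split q P z ⟩
  suc q * (suc q * P) + q * (z * (suc q * P)) + 2 * (z * (suc q * P))
    ≤⟨ +-monoˡ-≤ (2 * (z * (suc q * P)))
         (+-mono-≤ (*-monoʳ-≤ (suc q) (miss-bound q Z)) (*-monoʳ-≤ q (selects-bound q Z))) ⟩
  suc q * (suc q * d + z * P) + q * (suc q * (suc q * e) + z * (z * P)) + 2 * (z * (suc q * P))
    -- The added summand is the exact slack of the induction, so that `collect` is an identity.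
    ≤⟨ m≤m+n _ (z * (z * P) + suc q * P) ⟩
  suc q * (suc q * d + z * P) + q * (suc q * (suc q * e) + z * (z * P)) + 2 * (z * (suc q * P))
    + (z * (z * P) + suc q * P)
    ≡⟨ collect q P d e z ⟩
  suc q * (suc q * (d + q * e)) + suc z * (suc z * (suc q * P)) + z * (suc q * P) ∎)
  where
  z = ∣ Z ∣
  P = suc q ^ n
  d = 𝔼 q n (λ F → [ ∣ Z ∩ F ∣ ≐ 0 ])
  e = 𝔼 q n (λ F → [ ∣ Z ∩ F ∣ ≐ 1 ])
  split : ∀ q P z → (1 + z) * ((1 + q) * ((1 + q) * P)) + z * ((1 + q) * P)
                  ≡ (1 + q) * ((1 + q) * P) + q * (z * ((1 + q) * P)) + 2 * (z * ((1 + q) * P))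
  split = solve-∀
  collect : ∀ q P d e z →
    (1 + q) * ((1 + q) * d + z * P) + q * ((1 + q) * ((1 + q) * e) + z * (z * P))
      + 2 * (z * ((1 + q) * P)) + (z * (z * P) + (1 + q) * P)
    ≡ (1 + q) * ((1 + q) * (d + q * e)) + (1 + z) * ((1 + z) * ((1 + q) * P)) + z * ((1 + q) * P)
  collect = solve-∀

-- Doubling `∣ Z ∣` instead of halving `m` makes this cover every size from `⌊ m /2⌋ + 1` to `m`,
-- whatever the parity of `m`.
Middle : ∀ {n} → ℕ → Subset n → Set
Middle m Z = m ≤ 2 * ∣ Z ∣ × ∣ Z ∣ ≤ m

middle? : ∀ {n} m → Decidable (Middle {n} m)
middle? m Z = m ≤? 2 * ∣ Z ∣ ×-dec ∣ Z ∣ ≤? m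

-- With p = 1/(2m) and z = `∣ Z ∣`, the product zp lies between 1/4 and 1/2, so zp(1 - zp) ≥ 1/4 ·
-- 1/2 = 1/8.
middle-selected : ∀ q m {n} (Z : Subset n) → suc q ≡ 2 * m → Middle m Z →
  suc q ^ n ≤ 8 * 𝔼 q n (λ F → [ ∣ Z ∩ F ∣ ≐ 1 ])
middle-selected q m {n} Z M≡2m (m≤2z , z≤m) = *-cancelˡ-≤ M (*-cancelˡ-≤ M (begin
  M * (M * P)              ≡⟨ cong₂ (λ a b → a * (b * P)) M≡2m M≡2m ⟩
  2 * m * (2 * m * P)      ≡⟨ square m P ⟩
  m * (4 * (m * P))        ≤⟨ *-monoˡ-≤ (4 * (m * P)) m≤2z ⟩
  2 * z * (4 * (m * P))    ≡⟨ regroup m P z ⟩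
  8 * (z * (m * P))        ≤⟨ *-monoʳ-≤ 8 zmP≤MMe ⟩
  8 * (M * (M * e))        ≡⟨ pull M e ⟩
  M * (M * (8 * e))        ∎))
  where
  M = suc q
  z = ∣ Z ∣
  P = M ^ n
  e = 𝔼 q n (λ F → [ ∣ Z ∩ F ∣ ≐ 1 ])
  square : ∀ m P → 2 * m * (2 * m * P) ≡ m * (4 * (m * P))
  square = solve-∀
  regroup : ∀ m P z → 2 * z * (4 * (m * P)) ≡ 8 * (z * (m * P))
  regroup = solve-∀
  pull : ∀ M e → 8 * (M * (M * e)) ≡ M * (M * (8 * e))
  pull = solve-∀
  double : ∀ m P z → z * (m * P) + z * (m * P) ≡ z * (2 * m * P)
  double = solve-∀
  -- This is the factor 1 - zp ≥ 1/2, from `z ≤ m`.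
  zmP≤MMe : z * (m * P) ≤ M * (M * e)
  zmP≤MMe = +-cancelʳ-≤ (z * (m * P)) _ _ (begin
    z * (m * P) + z * (m * P)      ≡⟨ double m P z ⟩
    z * (2 * m * P)                ≡⟨ cong (λ a → z * (a * P)) M≡2m ⟨
    z * (M * P)                    ≤⟨ selects-bound q Z ⟩
    M * (M * e) + z * (z * P)      ≤⟨ +-monoʳ-≤ (M * (M * e)) (*-monoʳ-≤ z (*-monoˡ-≤ P z≤m)) ⟩
    M * (M * e) + z * (m * P)      ∎)

-- Greedy choice of selectors.

selected : ∀ {n} → List (Subset n) → Subset n → ℕ
selected []       F = 0
selected (Z ∷ Zs) F = [ ∣ Z ∩ F ∣ ≐ 1 ] + selected Zs F

unselected : ∀ {n} → List (Subset n) → Subset n → List (Subset n)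
unselected Zs F = filter (λ Z → ¬? (∣ Z ∩ F ∣ ≟ 1)) Zs

unselected+selected : ∀ {n} (Zs : List (Subset n)) F →
  length (unselected Zs F) + selected Zs F ≡ length Zs
unselected+selected []       F = refl
unselected+selected (Z ∷ Zs) F with ∣ Z ∩ F ∣ ≡ᵇ 1
... | true  = trans (+-suc _ _) (cong suc (unselected+selected Zs F))
... | false = cong suc (unselected+selected Zs F)

-- Linearity of expectation: `selected` is a sum of indicators, each of mean at least 1/8. The
-- parameter `pred (2 * m)` makes the inclusion probability 1/(2m).
𝔼-selected : ∀ m {n} .{{_ : NonZero m}} (Zs : List (Subset n)) → All (Middle m) Zs →
  (2 * m) ^ n * length Zs ≤ 8 * 𝔼 (pred (2 * m)) n (selected Zs)
𝔼-selected (suc m) {n} []       []         = ≤-trans (≤-reflexive (*-zeroʳ ((2 * suc m) ^ n))) z≤n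
𝔼-selected (suc m) {n} (Z ∷ Zs) (mid ∷ mids) = begin
  M ^ n * suc (length Zs)       ≡⟨ *-suc (M ^ n) (length Zs) ⟩
  M ^ n + M ^ n * length Zs     ≤⟨ +-mono-≤ (middle-selected (pred M) (suc m) Z refl mid) (𝔼-selected (suc m) Zs mids) ⟩
  8 * 𝔼 (pred M) n (λ F → [ ∣ Z ∩ F ∣ ≐ 1 ]) + 8 * 𝔼 (pred M) n (selected Zs)  ≡⟨ *-distribˡ-+ 8 (𝔼 (pred M) n (λ F → [ ∣ Z ∩ F ∣ ≐ 1 ])) _ ⟨
  8 * (𝔼 (pred M) n (λ F → [ ∣ Z ∩ F ∣ ≐ 1 ]) + 𝔼 (pred M) n (selected Zs))  ≡⟨ cong (8 *_) (𝔼-+ (pred M) n (λ F → [ ∣ Z ∩ F ∣ ≐ 1 ]) (selected Zs)) ⟨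
  8 * 𝔼 (pred M) n (selected (Z ∷ Zs)) ∎
  where M = 2 * suc m

-- An `F` attaining the average selects at least an eighth of the list, which leaves at most seven
-- eighths.
good-selector : ∀ m {n} .{{_ : NonZero m}} (Zs : List (Subset n)) → All (Middle m) Zs →
  ∃[ F ] 8 * length (unselected Zs F) ≤ 7 * length Zs
good-selector m@(suc _) {n} Zs mids with F , avg ← 𝔼-attained (pred (2 * m)) n (selected Zs) =
  F , +-cancelʳ-≤ (length Zs) _ _ (begin
    8 * r + length Zs             ≤⟨ +-monoʳ-≤ (8 * r) len≤ ⟩
    8 * r + 8 * selected Zs F     ≡⟨ *-distribˡ-+ 8 r (selected Zs F) ⟨
    8 * (r + selected Zs F)       ≡⟨ cong (8 *_) (unselected+selected Zs F) ⟩
    8 * length Zs                 ≡⟨ +-comm (length Zs) (7 * length Zs) ⟩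
    7 * length Zs + length Zs     ∎)
  where
  r = length (unselected Zs F)
  P = (2 * m) ^ n
  swap : ∀ P s → 8 * (P * s) ≡ P * (8 * s)
  swap = solve-∀
  len≤ : length Zs ≤ 8 * selected Zs F
  len≤ = *-cancelˡ-≤ P {{m^n≢0 (2 * m) n}} (begin
    P * length Zs                                ≤⟨ 𝔼-selected m Zs mids ⟩
    8 * 𝔼 (pred (2 * m)) n (selected Zs)         ≤⟨ *-monoʳ-≤ 8 avg ⟩
    8 * (P * selected Zs F)                      ≡⟨ swap P (selected Zs F) ⟩
    P * (8 * selected Zs F)                      ∎)

SelectedBy : ∀ {n} → List (Subset n) → Subset n → Set
SelectedBy Fs Z = Any (_Selects Z) Fs

-- Preserves the invariant of `greedy`: shrinking the list by the factor 7/8 pays for one round.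
contract : ∀ r l t → 8 * r ≤ 7 * l → l * 7 ^ suc t < 8 ^ suc t → r * 7 ^ t < 8 ^ t
contract r l t 8r≤7l l< = *-cancelˡ-< 8 _ _ (begin-strict
  8 * (r * 7 ^ t)    ≡⟨ *-assoc 8 r _ ⟨
  8 * r * 7 ^ t      ≤⟨ *-monoˡ-≤ (7 ^ t) 8r≤7l ⟩
  7 * l * 7 ^ t      ≡⟨ cong (_* 7 ^ t) (*-comm 7 l) ⟩
  l * 7 * 7 ^ t      ≡⟨ *-assoc l 7 _ ⟩
  l * 7 ^ suc t      <⟨ l< ⟩
  8 ^ suc t          ∎)

selectedBy-∷ : ∀ {n} F {Fs} (Zs : List (Subset n)) →
  (∀ {Z} → Z ∈ unselected Zs F → SelectedBy Fs Z) → ∀ {Z} → Z ∈ Zs → SelectedBy (F ∷ Fs) Z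
selectedBy-∷ F Zs covers {Z} Z∈Zs with ∣ Z ∩ F ∣ ≟ 1
... | yes sel = here sel
... | no ¬sel = there (covers (∈-filter⁺ (λ Z → ¬? (∣ Z ∩ F ∣ ≟ 1)) Z∈Zs ¬sel))

-- The numerical hypothesis says that `t` reductions by 7/8 leave fewer than one set, hence none.
greedy : ∀ m {n} .{{_ : NonZero m}} t (Zs : List (Subset n)) → All (Middle m) Zs →
  length Zs * 7 ^ t < 8 ^ t →
  ∃[ Fs ] (length Fs ≤ t × (∀ {Z} → Z ∈ Zs → SelectedBy Fs Z))
greedy m zero    []       _    _    = [] , z≤n , λ ()
greedy m zero    (_ ∷ _)  _    (s≤s ())
greedy m (suc t) Zs       mids few =
  let F , shrinks = good-selector m Zs mids
      Fs , short , covers = greedy m t (unselected Zs F) (filter⁺ (λ Z → ¬? (∣ Z ∩ F ∣ ≟ 1)) mids)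
                              (contract (length (unselected Zs F)) (length Zs) t shrinks few)
  in F ∷ Fs , s≤s short , selectedBy-∷ F Zs covers

^-distribʳ-* : ∀ m n o → (m * n) ^ o ≡ m ^ o * n ^ o
^-distribʳ-* m n zero    = refl
^-distribʳ-* m n (suc o) rewrite ^-distribʳ-* m n o = [m*n]*[o*p]≡[m*o]*[n*p] m n (m ^ o) (n ^ o)

-- Each block of `c` rounds at least halves the count. After `s` blocks at most one set can be left;
-- the extra block makes the inequality strict.
amplify : ∀ a b c {l} s .{{_ : NonZero a}} → 2 * a ^ c ≤ b ^ c → l ≤ 2 ^ s →
  l * a ^ (c * suc s) < b ^ (c * suc s)
amplify a b c {l} s 2aᶜ≤bᶜ l≤ = begin-strict
  l * a ^ (c * suc s)            ≡⟨ cong (l *_) (^-*-assoc a c (suc s)) ⟨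
  l * (a ^ c) ^ suc s            <⟨ *-monoˡ-< ((a ^ c) ^ suc s) {{m^n≢0 (a ^ c) (suc s) {{m^n≢0 a c}}}}
                                      (≤-<-trans l≤ (^-monoʳ-< 2 (s≤s (s≤s z≤n)) (n<1+n s))) ⟩
  2 ^ suc s * (a ^ c) ^ suc s    ≡⟨ ^-distribʳ-* 2 (a ^ c) (suc s) ⟨
  (2 * a ^ c) ^ suc s            ≤⟨ ^-monoˡ-≤ (suc s) 2aᶜ≤bᶜ ⟩
  (b ^ c) ^ suc s                ≡⟨ ^-*-assoc b c (suc s) ⟩
  b ^ (c * suc s)                ∎

-- 2 · 7⁶ ≤ 8⁶, so six rounds halve the number of unselected sets.
greedy-log : ∀ m {n} .{{_ : NonZero m}} s (Zs : List (Subset n)) → All (Middle m) Zs →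
  length Zs ≤ 2 ^ s →
  ∃[ Fs ] (length Fs ≤ 6 * suc s × (∀ {Z} → Z ∈ Zs → SelectedBy Fs Z))
greedy-log m s Zs mids few = greedy m (6 * suc s) Zs mids
  (amplify 7 8 6 s (≤ᵇ⇒≤ (2 * 7 ^ 6) (8 ^ 6) _) few)

-- Counting the small subsets.

smallSubsets : ∀ n → ℕ → List (Subset n)
smallSubsets zero    m       = [ [] ]
smallSubsets (suc n) zero    = map (outside ∷_) (smallSubsets n zero)
smallSubsets (suc n) (suc m) =
  map (inside ∷_) (smallSubsets n m) ++ map (outside ∷_) (smallSubsets n (suc m))

∈-smallSubsets : ∀ {n} m (Z : Subset n) → ∣ Z ∣ ≤ m → Z ∈ smallSubsets n m
∈-smallSubsets m       []            _       = here refl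
∈-smallSubsets zero    (outside ∷ Z) z≤m     = ∈-map⁺ _ (∈-smallSubsets zero Z z≤m)
∈-smallSubsets (suc m) (inside ∷ Z)  (s≤s z≤m) = ∈-++⁺ˡ (∈-map⁺ _ (∈-smallSubsets m Z z≤m))
∈-smallSubsets (suc m) (outside ∷ Z) z≤m     = ∈-++⁺ʳ _ (∈-map⁺ _ (∈-smallSubsets (suc m) Z z≤m))

-- Weighting Z by B^(−|Z|) ≥ B^(−m) and summing over all Z gives (1 + 1/B)ⁿ.
length-smallSubsets : ∀ B n m .{{_ : NonZero B}} →
  length (smallSubsets n m) * B ^ n ≤ B ^ m * suc B ^ n
length-smallSubsets B zero    m = begin
  1             ≤⟨ m^n>0 B m ⟩
  B ^ m         ≡⟨ *-identityʳ (B ^ m) ⟨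
  B ^ m * 1     ∎
length-smallSubsets B (suc n) zero = begin
  length (map (outside ∷_) (smallSubsets n 0)) * (B * B ^ n)
    ≡⟨ cong (_* (B * B ^ n)) (length-map _ (smallSubsets n 0)) ⟩
  length (smallSubsets n 0) * (B * B ^ n)    ≡⟨ pull B (length (smallSubsets n 0)) (B ^ n) ⟩
  B * (length (smallSubsets n 0) * B ^ n)    ≤⟨ *-mono-≤ (n≤1+n B) (length-smallSubsets B n zero) ⟩
  suc B * (1 * suc B ^ n)                    ≡⟨ cong (suc B *_) (*-identityˡ _) ⟩
  suc B ^ suc n                              ≡⟨ *-identityˡ _ ⟨
  1 * suc B ^ suc n                          ∎
  where
  pull : ∀ B l p → l * (B * p) ≡ B * (l * p)
  pull = solve-∀
length-smallSubsets B (suc n) (suc m) = begin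
  length (smallSubsets (suc n) (suc m)) * (B * B ^ n)
    ≡⟨ cong (_* (B * B ^ n)) (trans (length-++ (map (inside ∷_) (smallSubsets n m)))
         (cong₂ _+_ (length-map _ (smallSubsets n m)) (length-map _ (smallSubsets n (suc m))))) ⟩
  (a + b) * (B * B ^ n)                      ≡⟨ expand B (B ^ n) a b ⟩
  B * (a * B ^ n) + B * (b * B ^ n)
    ≤⟨ +-mono-≤ (*-monoʳ-≤ B (length-smallSubsets B n m)) (*-monoʳ-≤ B (length-smallSubsets B n (suc m))) ⟩
  B * (B ^ m * suc B ^ n) + B * (B * B ^ m * suc B ^ n)    ≡⟨ collect B (B ^ m) (suc B ^ n) ⟩
  B * B ^ m * (suc B * suc B ^ n)            ∎
  where
  a = length (smallSubsets n m)
  b = length (smallSubsets n (suc m))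
  expand : ∀ B p a b → (a + b) * (B * p) ≡ B * (a * p) + B * (b * p)
  expand = solve-∀
  collect : ∀ B p r → B * (p * r) + B * (B * p * r) ≡ B * p * ((1 + B) * r)
  collect = solve-∀

-- (1 + 1/B)^h ≤ 1 / (1 − h/B)
bernoulli : ∀ B h c → h + c ≤ B → suc B ^ h * c ≤ B * B ^ h
bernoulli B zero    c c≤B = begin
  1 * c    ≡⟨ *-identityˡ c ⟩
  c        ≤⟨ c≤B ⟩
  B        ≡⟨ *-identityʳ B ⟨
  B * 1    ∎
bernoulli B (suc h) c h+c<B = begin
  suc B * suc B ^ h * c        ≡⟨ swap (suc B) (suc B ^ h) c ⟩
  -- As c ≤ B, (B + 1)c ≤ B(c + 1): one factor 1 + 1/B is traded for raising `c` by one.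
  suc B ^ h * (c + B * c)      ≤⟨ *-monoʳ-≤ (suc B ^ h) (+-monoˡ-≤ (B * c) (≤-trans (m≤n+m c (suc h)) h+c<B)) ⟩
  suc B ^ h * (B + B * c)      ≡⟨ regroup (suc B ^ h) B c ⟩
  B * (suc B ^ h * suc c)      ≤⟨ *-monoʳ-≤ B (bernoulli B h (suc c) (≤-trans (≤-reflexive (+-suc h c)) h+c<B)) ⟩
  B * (B * B ^ h)              ∎
  where
  swap : ∀ a p c → a * p * c ≡ p * (a * c)
  swap = solve-∀
  regroup : ∀ p B c → p * (B + B * c) ≡ B * (p * (1 + c))
  regroup = solve-∀

-- `bernoulli` at B = 2h and c = h, where the bound B/c equals 2.
growth-short : ∀ h n .{{_ : NonZero h}} → n ≤ h → suc (2 * h) ^ n ≤ 2 * (2 * h) ^ n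
growth-short h n n≤h = *-cancelˡ-≤ h (begin
  h * suc (2 * h) ^ n            ≡⟨ *-comm h _ ⟩
  suc (2 * h) ^ n * h            ≤⟨ bernoulli (2 * h) n h (+-mono-≤ n≤h (m≤m+n h 0)) ⟩
  2 * h * (2 * h) ^ n            ≡⟨ swap h ((2 * h) ^ n) ⟩
  h * (2 * (2 * h) ^ n)          ∎)
  where
  swap : ∀ h p → 2 * h * p ≡ h * (2 * p)
  swap = solve-∀

-- Cut the exponent `n` into at most `m` blocks of length at most `h`; each block costs a factor 2.
growth : ∀ h n m .{{_ : NonZero h}} → n ≤ m * h → suc (2 * h) ^ n ≤ 2 ^ m * (2 * h) ^ n
growth h n zero    z≤n = ≤-refl
growth h n (suc m) n≤  with ≤-total n h
... | inj₁ n≤h = ≤-trans (growth-short h n n≤h) (*-monoˡ-≤ ((2 * h) ^ n) (*-monoʳ-≤ 2 (m^n>0 2 m)))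
... | inj₂ h≤n with n′ , refl ← m≤n⇒∃[o]m+o≡n h≤n = begin
  suc (2 * h) ^ (h + n′)                 ≡⟨ ^-distribˡ-+-* (suc (2 * h)) h n′ ⟩
  suc (2 * h) ^ h * suc (2 * h) ^ n′
    ≤⟨ *-mono-≤ (growth-short h h ≤-refl) (growth h n′ m (+-cancelˡ-≤ h _ _ n≤)) ⟩
  2 * (2 * h) ^ h * (2 ^ m * (2 * h) ^ n′)      ≡⟨ [m*n]*[o*p]≡[m*o]*[n*p] 2 ((2 * h) ^ h) (2 ^ m) _ ⟩
  2 ^ suc m * ((2 * h) ^ h * (2 * h) ^ n′)      ≡⟨ cong (2 ^ suc m *_) (^-distribˡ-+-* (2 * h) h n′) ⟨
  2 ^ suc m * (2 * h) ^ (h + n′)         ∎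

-- With B = 2 · 2^L, the factor B^m contributes (L + 1)m to the exponent, and (1 + 1/B)^n ≤ 2^m
-- contributes the remaining m.
few-smallSubsets : ∀ n m L → n ≤ m * 2 ^ L → length (smallSubsets n m) ≤ 2 ^ ((L + 2) * m)
few-smallSubsets n m L n≤ = *-cancelʳ-≤ _ _ (B ^ n) {{m^n≢0 B n {{B≢0}}}} (begin
  length (smallSubsets n m) * B ^ n    ≤⟨ length-smallSubsets B n m {{B≢0}} ⟩
  B ^ m * suc B ^ n                    ≤⟨ *-monoʳ-≤ (B ^ m) (growth (2 ^ L) n m {{m^n≢0 2 L}} n≤) ⟩
  B ^ m * (2 ^ m * B ^ n)              ≡⟨ *-assoc (B ^ m) (2 ^ m) (B ^ n) ⟨
  B ^ m * 2 ^ m * B ^ n                ≡⟨ cong (_* B ^ n) (begin-equality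
    B ^ m * 2 ^ m                        ≡⟨ cong (_* 2 ^ m) (^-*-assoc 2 (suc L) m) ⟩
    2 ^ (suc L * m) * 2 ^ m              ≡⟨ ^-distribˡ-+-* 2 (suc L * m) m ⟨
    2 ^ (suc L * m + m)                  ≡⟨ cong (2 ^_) (exponent L m) ⟩
    2 ^ ((L + 2) * m)                    ∎) ⟩
  2 ^ ((L + 2) * m) * B ^ n            ∎)
  where
  B = 2 ^ suc L
  B≢0 : NonZero B
  B≢0 = m^n≢0 2 (suc L)
  exponent : ∀ L m → (1 + L) * m + m ≡ (L + 2) * m
  exponent = solve-∀

-- Combining the scales k, k/2, k/4, ....

SelectorsUpTo : (n k L : ℕ) → Set
SelectorsUpTo n k L = ∃[ Fs ] (length Fs ≤ 24 * (k * (L + 4)) ×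
  (∀ (Z : Subset n) → Nonempty Z → ∣ Z ∣ ≤ k → SelectedBy Fs Z))

nonempty⇒∣p∣>0 : ∀ {n} {p : Subset n} → Nonempty p → 0 < ∣ p ∣
nonempty⇒∣p∣>0 (_ , x∈p) = ≤-<-trans z≤n (x∈p⇒∣p-x∣<∣p∣ x∈p)

-- One scale: `greedy-log` is run on all middle sets, of which there are at most 2^((L + 2)k).
level : ∀ n k L .{{_ : NonZero k}} → n ≤ k * 2 ^ L →
  ∃[ Fs ] (length Fs ≤ 6 * suc ((L + 2) * k) × (∀ (Z : Subset n) → Middle k Z → SelectedBy Fs Z))
level n k L n≤ =
  let Fs , short , covers = greedy-log k ((L + 2) * k) (filter (middle? k) (smallSubsets n k))
        (all-filter (middle? k) (smallSubsets n k))
        (≤-trans (length-filter (middle? k) (smallSubsets n k)) (few-smallSubsets n k L n≤))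
  in Fs , short , λ Z mid → covers (∈-filter⁺ (middle? k) (∈-smallSubsets k Z (proj₂ mid)) mid)

k≤1+2⌊k/2⌋ : ∀ k → k ≤ suc (2 * ⌊ k /2⌋)
k≤1+2⌊k/2⌋ zero          = z≤n
k≤1+2⌊k/2⌋ (suc zero)    = ≤-refl
k≤1+2⌊k/2⌋ (suc (suc k)) = s≤s (≤-trans (s≤s (k≤1+2⌊k/2⌋ k)) (≤-reflexive (sym (*-suc 2 ⌊ k /2⌋))))

2⌊k/2⌋≤k : ∀ k → 2 * ⌊ k /2⌋ ≤ k
2⌊k/2⌋≤k zero          = z≤n
2⌊k/2⌋≤k (suc zero)    = z≤n
2⌊k/2⌋≤k (suc (suc k)) = ≤-trans (≤-reflexive (*-suc 2 ⌊ k /2⌋)) (s≤s (s≤s (2⌊k/2⌋≤k k)))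

-- The length bound T(k, L) = 24k(L + 4) satisfies T(k, L) ≥ T(⌊k/2⌋, L + 2) + 6((L + 2)k + 1):
-- halving k raises L by at most 2, as k ≤ 4⌊k/2⌋ for k ≥ 2.
halving-bound : ∀ h k L → 1 ≤ k → 2 * h ≤ k →
  24 * (h * (L + 2 + 4)) + 6 * suc ((L + 2) * k) ≤ 24 * (k * (L + 4))
halving-bound h k L 1≤k 2h≤k = begin
  24 * (h * (L + 2 + 4)) + 6 * suc ((L + 2) * k)          ≡⟨ lhs h k L ⟩
  6 * (2 * (2 * h * (L + 6)) + (L + 2) * k + 1)
    ≤⟨ *-monoʳ-≤ 6 (+-mono-≤ (+-monoˡ-≤ ((L + 2) * k) (*-monoʳ-≤ 2 (*-monoˡ-≤ (L + 6) 2h≤k))) 1≤k) ⟩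
  6 * (2 * (k * (L + 6)) + (L + 2) * k + k)               ≤⟨ *-monoʳ-≤ 6 (m≤m+n (2 * (k * (L + 6)) + (L + 2) * k + k) (k * L + k)) ⟩
  6 * (2 * (k * (L + 6)) + (L + 2) * k + k + (k * L + k)) ≡⟨ cong (6 *_) (rhs k L) ⟩
  6 * (4 * (k * (L + 4)))                                 ≡⟨ *-assoc 6 4 (k * (L + 4)) ⟨
  24 * (k * (L + 4))                                      ∎
  where
  lhs : ∀ h k L → 24 * (h * (L + 2 + 4)) + 6 * (1 + (L + 2) * k) ≡ 6 * (2 * (2 * h * (L + 6)) + (L + 2) * k + 1)
  lhs = solve-∀
  rhs : ∀ k L → 2 * (k * (L + 6)) + (L + 2) * k + k + (k * L + k) ≡ 4 * (k * (L + 4))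
  rhs = solve-∀

-- A set with more than `⌊ k /2⌋` points is in the middle range, since k ≤ 2⌊k/2⌋ + 1; `Fs` handles
-- all smaller ones.
selectedBy-++ : ∀ {n} k Fs Gs →
  (∀ (Z : Subset n) → Nonempty Z → ∣ Z ∣ ≤ ⌊ k /2⌋ → SelectedBy Fs Z) →
  (∀ (Z : Subset n) → Middle k Z → SelectedBy Gs Z) →
  ∀ (Z : Subset n) → Nonempty Z → ∣ Z ∣ ≤ k → SelectedBy (Fs ++ Gs) Z
selectedBy-++ k Fs Gs small middle Z ne z≤k with ∣ Z ∣ ≤? ⌊ k /2⌋
... | yes z≤h = ++⁺ˡ (small Z ne z≤h)
... | no  z≰h = ++⁺ʳ Fs (middle Z (k≤2z , z≤k))
  where
  k≤2z : k ≤ 2 * ∣ Z ∣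
  k≤2z = begin
    k                    ≤⟨ k≤1+2⌊k/2⌋ k ⟩
    suc (2 * ⌊ k /2⌋)    ≤⟨ n≤1+n _ ⟩
    2 + 2 * ⌊ k /2⌋      ≡⟨ *-suc 2 ⌊ k /2⌋ ⟨
    2 * suc ⌊ k /2⌋      ≤⟨ *-monoʳ-≤ 2 (≰⇒> z≰h) ⟩
    2 * ∣ Z ∣            ∎

halving : ∀ n k L .{{_ : NonZero k}} → n ≤ k * 2 ^ L →
  SelectorsUpTo n ⌊ k /2⌋ (L + 2) → SelectorsUpTo n k L
halving n k L n≤ (Fs , short , covers) =
  let Gs , short′ , covers′ = level n k L n≤
  in Fs ++ Gs
   , ≤-trans (≤-reflexive (length-++ Fs))
       (≤-trans (+-mono-≤ short short′) (halving-bound ⌊ k /2⌋ k L (>-nonZero⁻¹ k) (2⌊k/2⌋≤k k)))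
   , selectedBy-++ k Fs Gs covers covers′

selectors : ∀ n k L → 1 ≤ k → n ≤ k * 2 ^ L → SelectorsUpTo n k L
selectors n = <-rec (λ k → ∀ L → 1 ≤ k → n ≤ k * 2 ^ L → SelectorsUpTo n k L) step
  where
  step : ∀ k → (∀ {h} → h < k → ∀ L → 1 ≤ h → n ≤ h * 2 ^ L → SelectorsUpTo n h L) →
    ∀ L → 1 ≤ k → n ≤ k * 2 ^ L → SelectorsUpTo n k L
  -- At k = 1 every `Z` in question is a singleton, and the full set selects it.
  step 1 rec L _ _ = [ ⊤ ] , ≤-trans (m≤n+m 1 L) (≤-trans (+-monoʳ-≤ L (s≤s z≤n)) (≤-trans (m≤m+n (L + 4) 0) (m≤m+n _ _))) ,
    λ Z ne z≤1 → here (trans (cong ∣_∣ (∩-identityʳ Z)) (≤-antisym z≤1 (nonempty⇒∣p∣>0 ne)))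
  step k@(suc (suc j)) rec L _ n≤ = halving n k L n≤
    (rec (⌊n/2⌋<n (suc j)) (L + 2) (s≤s z≤n) (begin
      n                        ≤⟨ n≤ ⟩
      k * 2 ^ L                ≤⟨ *-monoˡ-≤ (2 ^ L) k≤4h ⟩
      h * 4 * 2 ^ L            ≡⟨ *-assoc h 4 (2 ^ L) ⟩
      h * (2 ^ 2 * 2 ^ L)      ≡⟨ cong (h *_) (*-comm (2 ^ 2) (2 ^ L)) ⟩
      h * (2 ^ L * 2 ^ 2)      ≡⟨ cong (h *_) (^-distribˡ-+-* 2 L 2) ⟨
      h * 2 ^ (L + 2)          ∎))
    where
    h = ⌊ k /2⌋
    split : ∀ h → 2 * h + 2 * h ≡ h * 4
    split = solve-∀
    k≤4h : k ≤ h * 4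
    k≤4h = begin
      k                  ≤⟨ k≤1+2⌊k/2⌋ k ⟩
      -- Here `h` is positive because `k` is at least 2.
      1 + 2 * h          ≤⟨ +-monoˡ-≤ (2 * h) (s≤s z≤n) ⟩
      2 * h + 2 * h      ≡⟨ split h ⟩
      h * 4              ∎

-- Rounding of the logarithm and the final bound.

n<2^1+⌊log₂n⌋ : ∀ n → n < 2 ^ suc ⌊log₂ n ⌋
n<2^1+⌊log₂n⌋ n with 2 ^ suc ⌊log₂ n ⌋ ≤? n
... | no  ≰n = ≰⇒> ≰n
-- Monotonicity of `⌊log₂_⌋` would give `suc ⌊log₂ n ⌋ ≤ ⌊log₂ n ⌋`.
... | yes ≤n = contradiction
  (≤-trans (≤-reflexive (sym (⌊log₂[2^n]⌋≡n (suc ⌊log₂ n ⌋)))) (⌊log₂⌋-mono-≤ ≤n)) 1+n≰n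

-- The extra 1 in the exponent pays for both roundings, that of the quotient and that of the
-- logarithm.
n≤k*2^logRatio+1 : ∀ n k .{{_ : NonZero k}} → n ≤ k * 2 ^ suc (logRatio n k)
n≤k*2^logRatio+1 n k = begin
  n                          ≡⟨ m≡m%n+[m/n]*n n k ⟩
  n % k + n / k * k          ≤⟨ +-monoˡ-≤ (n / k * k) (<⇒≤ (m%n<n n k)) ⟩
  suc (n / k) * k            ≡⟨ *-comm (suc (n / k)) k ⟩
  k * suc (n / k)            ≤⟨ *-monoʳ-≤ k (n<2^1+⌊log₂n⌋ (n / k)) ⟩
  k * 2 ^ suc ⌊log₂ n / k ⌋  ≤⟨ *-monoʳ-≤ k (^-monoʳ-≤ 2 (s≤s (m≤n⊔m 1 ⌊log₂ n / k ⌋))) ⟩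
  k * 2 ^ suc (logRatio n k) ∎

-- The convention that the logarithmic factor is at least 1 enters here: ℓ + 5 ≤ 6ℓ, and 24 · 6 =
-- 144.
absorb-constants : ∀ k ℓ → 1 ≤ ℓ → 24 * (k * (suc ℓ + 4)) ≤ 144 * (k * ℓ)
absorb-constants k ℓ 1≤ℓ = begin
  24 * (k * (suc ℓ + 4))      ≤⟨ *-monoʳ-≤ 24 (*-monoʳ-≤ k (begin
    suc ℓ + 4                    ≡⟨ +-suc ℓ 4 ⟨
    ℓ + 5 * 1                    ≤⟨ +-monoʳ-≤ ℓ (*-monoʳ-≤ 5 1≤ℓ) ⟩
    6 * ℓ                        ∎)) ⟩
  24 * (k * (6 * ℓ))          ≡⟨ cong (24 *_) (pull k ℓ) ⟩
  24 * (6 * (k * ℓ))          ≡⟨ *-assoc 24 6 (k * ℓ) ⟨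
  144 * (k * ℓ)               ∎
  where
  pull : ∀ k ℓ → k * (6 * ℓ) ≡ 6 * (k * ℓ)
  pull = solve-∀

-- The list of selectors may contain repetitions. Removing them keeps every member and does not
-- increase the length.
selective-family : ∀ n k L .{{_ : NonZero k}} → n ≤ k * 2 ^ L →
  ∃[ 𝓕 ] (Selective n k 𝓕 × size 𝓕 ≤ 24 * (k * (L + 4)))
selective-family n k L n≤ =
  let Fs , short , covers = selectors n k L (>-nonZero⁻¹ k) n≤
  in record { members = deduplicate _≟ˢ_ Fs ; distinct = deduplicate-! _≟ˢ_ Fs }
   , (λ Z ne z≤k → let F , F∈Fs , sel = find (covers Z ne z≤k) in lose (∈-deduplicate⁺ _≟ˢ_ F∈Fs) sel)
   , ≤-trans (length-deduplicate _≟ˢ_ Fs) short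
  where
  _≟ˢ_ : DecidableEquality (Subset n)
  _≟ˢ_ = ≡-dec _≟ᵇ_

theorem3p1 : ∃[ C ] (∀ (n k : ℕ) → .{{_ : NonZero k}} →
    n > 2 → k ≥ 2 → k ≤ n →
    ∃[ 𝓕 ] (Selective n k 𝓕 × size 𝓕 ≤ C * (k * logRatio n k)))
theorem3p1 = 144 , λ n k _ _ _ →
  let 𝓕 , selective , small = selective-family n k (suc (logRatio n k)) (n≤k*2^logRatio+1 n k)
  in 𝓕 , selective , ≤-trans small (absorb-constants k (logRatio n k) (m≤m⊔n 1 ⌊log₂ n / k ⌋))
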